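{- There is an absolute constant $c>0$ such that for every $n\ge 2$ and every $f\colon\{0,1\}^n\to\{0,1\}$ that depends on all $n$ variables, $\mathrm{rdeg}(f)\ge c\log n$ (that is, $\mathrm{rdeg}(f)\ge\Omega(\log n)$).
   Context: $f$ depends on variable $i$ if there is $x\in\{0,1\}^n$ with $f(x)\neq f(x^i)$, where $x^i$ is $x$ with the $i$th bit flipped. A rational representation of $f$ is a pair of multilinear $p,q\in\mathbb{R}[X_1,\dots,X_n]$ with $q(x)\neq 0$ and $p(x)/q(x)=f(x)$ for all $x\in\{0,1\}^n$; $\mathrm{rdeg}(f)$ is the minimum of $\max(\deg p,\deg q)$ over rational representations.
   Formalization: The multilinear polynomials p and q in a rational representation are taken with rational rather than real coefficients, so rdeg(f) is the minimum over representations with rational coefficients. -}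

module Defs where

open import Data.Bool using (Bool; true; false; not)
open import Data.Nat using (ℕ; zero; suc; _≤_)
open import Data.Fin using (Fin)
open import Data.Vec using (Vec; []; _∷_; _[_]%=_)
open import Data.List using (List; []; _∷_; map; _++_; foldr)
open import Data.Fin.Subset using (Subset) renaming (∣_∣ to size)
open import Data.Rational using (ℚ; 0ℚ; 1ℚ; _+_; _*_)
open import Data.Product using (∃; _×_)
open import Relation.Binary.PropositionalEquality using (_≡_; _≢_)

Cube : ℕ → Set
Cube n = Vec Bool n

BoolFun : ℕ → Set
BoolFun n = Cube n → Bool

flipAt : ∀ {n} → Cube n → Fin n → Cube n
flipAt x i = x [ i ]%= not

DependsOn : ∀ {n} → BoolFun n → Fin n → Set
DependsOn f i = ∃ λ x → f x ≢ f (flipAt x i)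

DependsOnAll : ∀ {n} → BoolFun n → Set
DependsOnAll {n} f = (i : Fin n) → DependsOn f i

toℚ : Bool → ℚ
toℚ true  = 1ℚ
toℚ false = 0ℚ

allSubsets : (n : ℕ) → List (Subset n)
allSubsets zero    = [] ∷ []
allSubsets (suc n) = map (false ∷_) (allSubsets n) ++ map (true ∷_) (allSubsets n)

monomial : ∀ {n} → Subset n → Cube n → ℚ
monomial []          []      = 1ℚ
monomial (false ∷ S) (_ ∷ x) = monomial S x
monomial (true  ∷ S) (b ∷ x) = toℚ b * monomial S x

-- A multilinear polynomial in X_1..X_n with rational coefficients,
-- given by its coefficient c(S) of the monomial ∏_{i∈S} X_i.
Multilinear : ℕ → Set
Multilinear n = Subset n → ℚ

eval : ∀ {n} → Multilinear n → Cube n → ℚ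
eval {n} p x = foldr _+_ 0ℚ (map (λ S → p S * monomial S x) (allSubsets n))

DegreeAtMost : ∀ {n} → Multilinear n → ℕ → Set
DegreeAtMost p d = ∀ S → p S ≢ 0ℚ → size S ≤ d

-- (p , q) is a rational representation of f:
-- q(x) ≠ 0 and p(x)/q(x) = f(x) (written as p(x) = f(x)·q(x)) on the cube.
IsRationalRep : ∀ {n} → BoolFun n → Multilinear n → Multilinear n → Set
IsRationalRep f p q = ∀ x → (eval q x ≢ 0ℚ) × (eval p x ≡ toℚ (f x) * eval q x)

RdegAtMost : ∀ {n} → BoolFun n → ℕ → Set
RdegAtMost {n} f d =
  ∃ λ (p : Multilinear n) → ∃ λ (q : Multilinear n) →
    IsRationalRep f p q × DegreeAtMost p d × DegreeAtMost q d

{-# OPTIONS --safe #-}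
module Submission where

-- With r = q - p, the polynomial p is nonzero exactly where f = 1 and r exactly where f = 0.
-- Since p(x) r(xⁱ) has degree ≤ 2d and is not identically zero, each variable has influence at least
-- 4^(-d), so it suffices to bound the total sensitivity of f by 2^O(d) · 2ⁿ.
--
-- Let x maximise |p|. A nonzero polynomial of degree ≤ d has a nonzero value within distance d of any
-- point, so one can greedily collect disjoint blocks of size ≤ d around x, each of whose flips makes r
-- nonzero and hence p zero. Flipping s blocks independently gives a polynomial h of degree ≤ d on the
-- s-cube with |h| ≤ h(0) (up to sign) and h(eᵢ) = 0, and a Markov-type inequality for the sum of the linear
-- coefficients forces s ≤ 5^d. The blocks collected form a certificate of size ≤ d 5^d: fixing their
-- variables as in x makes r vanish, so fixing them in any way lowers the degree of r. Iterating d + 1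
-- times makes f constant.

open import Defs
open import Data.Bool using (Bool; true; false; not; if_then_else_; _xor_)
open import Data.Bool.Properties using (not-involutive)
open import Data.Fin using (Fin; zero; suc)
open import Data.Fin.Subset using (Subset; ∁; ⊥; _∪_) renaming (∣_∣ to size)
open import Data.Fin.Subset.Properties using (∣⊥∣≡0)
open import Data.List as List using (List; foldr; map; _++_)
open import Data.Nat as ℕ using (ℕ; zero; suc; z≤n; s≤s)
import Data.Nat.Properties as ℕₚ
import Data.Nat.Tactic.RingSolver as ℕ-Ring
open import Data.Product using (∃; _×_; _,_)
open import Data.Rational
  using (ℚ; 0ℚ; 1ℚ; ½; _+_; _*_; _-_; -_; 1/_; ∣_∣; _≤_; _<_; _≟_; NonZero; ≢-nonZero)
import Data.Rational.Properties as ℚₚ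
open import Data.Rational.Solver using (module +-*-Solver)
open import Data.Sum using (_⊎_; inj₁; inj₂)
open import Data.Vec using ([]; _∷_; replicate; zipWith)
open import Function using (_∘_)
open import Relation.Binary.PropositionalEquality
open import Relation.Nullary using (yes; no; contradiction)
open import Relation.Nullary.Decidable using (decidable-stable; toWitness)

open import Algebra.Properties.Monoid.Mult ℚₚ.+-0-monoid using (×-assocˡ) renaming (_×_ to _·_)
open import Algebra.Properties.Monoid.Sum ℕₚ.+-0-monoid using (sum)
open +-*-Solver

private variable
  n k l : ℕ
  g h : Cube n → ℚ

-- Multilinear degree of functions on the cube, through discrete derivatives

δ : (Cube (suc n) → ℚ) → Cube n → ℚ
δ g x = g (true ∷ x) - g (false ∷ x)

-- Multilinear degree < k of a function on the cube; Deg< 0 g says that g is zero.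
data Deg< : ℕ → (Cube n → ℚ) → Set where
  vanish : (∀ x → g x ≡ 0ℚ) → Deg< 0 g
  point  : {g : Cube 0 → ℚ} → Deg< (suc k) g
  step   : {g : Cube (suc n) → ℚ} →
           Deg< (suc k) (g ∘ (false ∷_)) → Deg< k (δ g) → Deg< (suc k) g

Deg<-resp : Deg< k g → g ≗ h → Deg< k h
Deg<-resp (vanish e) g≗h = vanish λ x → trans (sym (g≗h x)) (e x)
Deg<-resp point g≗h = point
Deg<-resp (step a b) g≗h =
  step (Deg<-resp a (g≗h ∘ _)) (Deg<-resp b λ x → cong₂ _-_ (g≗h _) (g≗h _))

Deg<-zero : ∀ {n k} {g : Cube n → ℚ} → (∀ x → g x ≡ 0ℚ) → Deg< k g
Deg<-zero {n} {zero} e = vanish e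
Deg<-zero {zero} {suc k} e = point
Deg<-zero {suc n} {suc k} e =
  step (Deg<-zero (e ∘ _)) (Deg<-zero λ x → cong₂ _-_ (e _) (e _))

Deg<-suc : Deg< k g → Deg< (suc k) g
Deg<-suc (vanish e) = Deg<-zero e
Deg<-suc point = point
Deg<-suc (step a b) = step (Deg<-suc a) (Deg<-suc b)

Deg<-lincomb : ∀ {n k} {g h : Cube n → ℚ} a b → Deg< k g → Deg< k h → Deg< k (λ x → a * g x + b * h x)
Deg<-lincomb a b (vanish e) (vanish e′) = vanish λ x →
  trans (cong₂ (λ u v → a * u + b * v) (e x) (e′ x))
        (solve 2 (λ a b → a :* con 0ℚ :+ b :* con 0ℚ := con 0ℚ) refl a b)
Deg<-lincomb a b point point = point
Deg<-lincomb {suc n} {suc k} {g} {h} a b (step p q) (step p′ q′) =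
  step (Deg<-lincomb a b p p′) (Deg<-resp (Deg<-lincomb a b q q′) λ x →
    solve 6 (λ a b g₁ g₀ h₁ h₀ → a :* (g₁ :- g₀) :+ b :* (h₁ :- h₀)
                              := (a :* g₁ :+ b :* h₁) :- (a :* g₀ :+ b :* h₀)) refl a b
      (g (true ∷ x)) (g (false ∷ x)) (h (true ∷ x)) (h (false ∷ x)))

Deg<-+ : Deg< k g → Deg< k h → Deg< k (λ x → g x + h x)
Deg<-+ {g = g} {h = h} p q = Deg<-resp (Deg<-lincomb 1ℚ 1ℚ p q) λ x →
  cong₂ _+_ (ℚₚ.*-identityˡ (g x)) (ℚₚ.*-identityˡ (h x))

Deg<-minus : Deg< k g → Deg< k h → Deg< k (λ x → g x - h x)
Deg<-minus {g = g} {h = h} p q = Deg<-resp (Deg<-lincomb 1ℚ (- 1ℚ) p q) λ x →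
  solve 2 (λ u v → con 1ℚ :* u :+ con (- 1ℚ) :* v := u :- v) refl (g x) (h x)

Deg<-half : ∀ b {g : Cube (suc n) → ℚ} → Deg< k g → Deg< k (g ∘ (b ∷_))
Deg<-half b (vanish e) = vanish (e ∘ _)
Deg<-half false (step p q) = p
Deg<-half true {g} (step p q) = Deg<-resp (Deg<-+ (Deg<-suc q) p) λ x →
  solve 2 (λ u v → u :- v :+ v := u) refl (g (true ∷ x)) (g (false ∷ x))

-- Discrete Leibniz rule: the derivative of a product splits into two terms, each containing one
-- derivative. The bounds are strict, so degrees at most k - 1 and l add up to less than k + l.
Deg<-* : ∀ {n k l} {g h : Cube n → ℚ} → Deg< k g → Deg< (suc l) h → Deg< (k ℕ.+ l) (λ x → g x * h x)
Deg<-* {h = h} (vanish e) q = Deg<-zero λ x →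
  trans (cong (_* h x) (e x)) (ℚₚ.*-zeroˡ (h x))
Deg<-* point q = point
Deg<-* {suc n} {suc k} {l} {g} {h} (step p p′) q@(step r r′) =
  step (Deg<-* p r)
    (Deg<-resp (Deg<-+ (Deg<-* p′ (Deg<-half true q))
                       (subst (λ j → Deg< j (λ x → δ h x * g (false ∷ x)))
                         (ℕₚ.+-comm l k) (Deg<-* r′ p))) λ x →
      solve 4 (λ g₁ g₀ h₁ h₀ → (g₁ :- g₀) :* h₁ :+ (h₁ :- h₀) :* g₀ := g₁ :* h₁ :- g₀ :* h₀) refl
        (g (true ∷ x)) (g (false ∷ x)) (h (true ∷ x)) (h (false ∷ x)))

flip-Deg< : ∀ i → Deg< k g → Deg< k (λ x → g (flipAt x i))
flip-Deg< i (vanish e) = vanish λ x → e _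
flip-Deg< {g = g} zero p@(step a b) =
  -- Swapping the halves negates the derivative; the negation is written as the combination 0·δ -
  -- 1·δ.
  step (Deg<-half true p) (Deg<-resp (Deg<-lincomb 0ℚ (- 1ℚ) b b) λ x →
    solve 2 (λ u v → con 0ℚ :* (u :- v) :+ con (- 1ℚ) :* (u :- v) := v :- u) refl
      (g (true ∷ x)) (g (false ∷ x)))
flip-Deg< (suc i) (step a b) = step (flip-Deg< i a) (flip-Deg< i b)

-- Degree of a polynomial given by coefficients

sumℚ : {A : Set} → (A → ℚ) → List A → ℚ
sumℚ F xs = foldr _+_ 0ℚ (map F xs)

sumℚ-++ : ∀ {A : Set} (F : A → ℚ) xs ys → sumℚ F (xs ++ ys) ≡ sumℚ F xs + sumℚ F ys
sumℚ-++ F List.[] ys = sym (ℚₚ.+-identityˡ _)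
sumℚ-++ F (x List.∷ xs) ys =
  trans (cong (F x +_) (sumℚ-++ F xs ys)) (sym (ℚₚ.+-assoc (F x) (sumℚ F xs) (sumℚ F ys)))

sumℚ-map : ∀ {A B : Set} (F : B → ℚ) (j : A → B) xs → sumℚ F (map j xs) ≡ sumℚ (F ∘ j) xs
sumℚ-map F j List.[] = refl
sumℚ-map F j (x List.∷ xs) = cong (F (j x) +_) (sumℚ-map F j xs)

sumℚ-cong : ∀ {A : Set} {F G : A → ℚ} → F ≗ G → ∀ xs → sumℚ F xs ≡ sumℚ G xs
sumℚ-cong F≗G List.[] = refl
sumℚ-cong F≗G (x List.∷ xs) = cong₂ _+_ (F≗G x) (sumℚ-cong F≗G xs)

sumℚ-zero : ∀ {A : Set} {F : A → ℚ} → (∀ x → F x ≡ 0ℚ) → ∀ xs → sumℚ F xs ≡ 0ℚ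
sumℚ-zero e List.[] = refl
sumℚ-zero e (x List.∷ xs) = cong₂ _+_ (e x) (sumℚ-zero e xs)

eval-split : ∀ (p : Multilinear (suc n)) b x →
  eval p (b ∷ x) ≡ eval (p ∘ (false ∷_)) x
                 + sumℚ (λ S → p (true ∷ S) * (toℚ b * monomial S x)) (allSubsets n)
eval-split {n} p b x =
  trans (sumℚ-++ F (map (false ∷_) (allSubsets n)) (map (true ∷_) (allSubsets n)))
        (cong₂ _+_ (sumℚ-map F (false ∷_) (allSubsets n)) (sumℚ-map F (true ∷_) (allSubsets n)))
  where
  F : Subset (suc n) → ℚ
  F S = p S * monomial S (b ∷ x)

eval-false : ∀ (p : Multilinear (suc n)) x → eval (p ∘ (false ∷_)) x ≡ eval p (false ∷ x)
eval-false {n} p x = sym (trans (eval-split p false x)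
  (trans (cong (eval (p ∘ (false ∷_)) x +_)
           (sumℚ-zero (λ S → solve 2 (λ u v → u :* (con 0ℚ :* v) := con 0ℚ) refl
                              (p (true ∷ S)) (monomial S x)) (allSubsets n)))
         (ℚₚ.+-identityʳ _)))

eval-δ : ∀ (p : Multilinear (suc n)) x → eval (p ∘ (true ∷_)) x ≡ δ (eval p) x
eval-δ {n} p x = sym (trans
  (cong₂ _-_ (eval-split p true x) (sym (eval-false p x)))
  (trans (solve 2 (λ u v → (u :+ v) :- u := v) refl
           (eval (p ∘ (false ∷_)) x) (sumℚ (λ S → p (true ∷ S) * (1ℚ * monomial S x)) (allSubsets n)))
         (sumℚ-cong (λ S → cong (p (true ∷ S) *_) (ℚₚ.*-identityˡ (monomial S x))) (allSubsets n))))

-- The coefficients of sets without the first variable give the restriction to `false`, and those of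
-- sets containing it give the derivative, where every set has lost one element.
eval-Deg< : ∀ n k (p : Multilinear n) → (∀ S → p S ≢ 0ℚ → size S ℕ.< k) → Deg< k (eval p)
eval-Deg< n zero p sz = vanish λ x → sumℚ-zero (λ S →
  trans (cong (_* monomial S x)
          (decidable-stable (p S ≟ 0ℚ) λ pS≢0 → ℕₚ.n≮0 (sz S pS≢0)))
        (ℚₚ.*-zeroˡ (monomial S x))) (allSubsets n)
eval-Deg< zero (suc k) p sz = point
eval-Deg< (suc n) (suc k) p sz = step
  (Deg<-resp (eval-Deg< n (suc k) _ (λ S → sz (false ∷ S))) (eval-false p))
  (Deg<-resp (eval-Deg< n k _ (λ S → ℕ.s≤s⁻¹ ∘ sz (true ∷ S))) (eval-δ p))

-- Nonzero values of low-degree functions: how many and how near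

Σᶜ : (Cube n → ℕ) → ℕ
Σᶜ {zero} F = F []
Σᶜ {suc n} F = Σᶜ (F ∘ (false ∷_)) ℕ.+ Σᶜ (F ∘ (true ∷_))

Σᶜ-mono : ∀ {n} {F G : Cube n → ℕ} → (∀ x → F x ℕ.≤ G x) → Σᶜ F ℕ.≤ Σᶜ G
Σᶜ-mono {zero} le = le []
Σᶜ-mono {suc n} le = ℕₚ.+-mono-≤ (Σᶜ-mono λ x → le (false ∷ x)) (Σᶜ-mono λ x → le (true ∷ x))

isNonzero : ℚ → ℕ
isNonzero q with q ≟ 0ℚ
... | yes _ = 0
... | no  _ = 1

-- When one half is zero, the other half equals the derivative up to sign, so its degree is one
-- lower.
vanishing-half : ∀ {n k} {g : Cube (suc n) → ℚ} b → Deg< (suc k) g →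
                 (∀ x → g (b ∷ x) ≡ 0ℚ) → Deg< k (g ∘ (not b ∷_))
vanishing-half {g = g} false (step p q) e = Deg<-resp q λ x →
  trans (cong (λ z → g (true ∷ x) - z) (e x)) (ℚₚ.+-identityʳ _)
vanishing-half {g = g} true (step p q) e = Deg<-resp (Deg<-lincomb (- 1ℚ) 0ℚ q q) λ x →
  trans (cong (λ z → - 1ℚ * (z - g (false ∷ x)) + 0ℚ * (z - g (false ∷ x))) (e x))
    (solve 1 (λ u → con (- 1ℚ) :* (con 0ℚ :- u) :+ con 0ℚ :* (con 0ℚ :- u) := u) refl (g (false ∷ x)))

halves≡0 : ∀ {g : Cube (suc n) → ℚ} b → (∀ x → g (b ∷ x) ≡ 0ℚ) → (∀ x → g (not b ∷ x) ≡ 0ℚ) →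
           ∀ x → g x ≡ 0ℚ
halves≡0 false e e′ (false ∷ x) = e x
halves≡0 false e e′ (true ∷ x) = e′ x
halves≡0 true e e′ (false ∷ x) = e′ x
halves≡0 true e e′ (true ∷ x) = e x

double-≤ : ∀ a k {s t} → a ℕ.≤ 2 ℕ.^ k ℕ.* s → s ℕ.≤ t → 2 ℕ.* a ℕ.≤ 2 ℕ.^ suc k ℕ.* t
double-≤ a k {s} {t} a≤ s≤t = begin
  2 ℕ.* a                  ≤⟨ ℕₚ.*-monoʳ-≤ 2 (ℕₚ.≤-trans a≤ (ℕₚ.*-monoʳ-≤ (2 ℕ.^ k) s≤t)) ⟩
  2 ℕ.* (2 ℕ.^ k ℕ.* t)    ≡⟨ ℕₚ.*-assoc 2 (2 ℕ.^ k) t ⟨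
  2 ℕ.^ suc k ℕ.* t        ∎
  where open ℕₚ.≤-Reasoning

-- If both halves are nonzero, their counts add up. If one vanishes, the other has lower degree, and
-- this regains the factor 2 lost by halving the cube. The extra factor 2 on the left accounts for
-- the strict degree bound.
schwartz-zippel : ∀ {n k} {g : Cube n → ℚ} → Deg< k g →
                  (∀ x → g x ≡ 0ℚ) ⊎ 2 ℕ.^ suc n ℕ.≤ 2 ℕ.^ k ℕ.* Σᶜ (isNonzero ∘ g)
schwartz-zippel (vanish e) = inj₁ e
schwartz-zippel {k = suc k} {g} point with g [] ≟ 0ℚ
... | yes e = inj₁ λ { [] → e }
... | no  _ = inj₂ (ℕₚ.≤-trans (ℕₚ.^-monoʳ-≤ 2 (s≤s (z≤n {k}))) (ℕₚ.≤-reflexive (sym (ℕₚ.*-identityʳ _))))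
schwartz-zippel {suc n} {suc k} {g} p
  with schwartz-zippel (Deg<-half false p) | schwartz-zippel (Deg<-half true p)
... | inj₁ e | inj₁ e′ = inj₁ (halves≡0 false e e′)
... | inj₂ u | inj₂ v = inj₂ (begin
  2 ℕ.^ suc (suc n)                           ≡⟨ cong (2 ℕ.^ suc n ℕ.+_) (ℕₚ.+-identityʳ (2 ℕ.^ suc n)) ⟩
  2 ℕ.^ suc n ℕ.+ 2 ℕ.^ suc n                 ≤⟨ ℕₚ.+-mono-≤ u v ⟩
  2 ℕ.^ suc k ℕ.* s₀ ℕ.+ 2 ℕ.^ suc k ℕ.* s₁   ≡⟨ ℕₚ.*-distribˡ-+ (2 ℕ.^ suc k) s₀ s₁ ⟨
  2 ℕ.^ suc k ℕ.* (s₀ ℕ.+ s₁)                 ∎)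
  where
  open ℕₚ.≤-Reasoning
  s₀ = Σᶜ (isNonzero ∘ g ∘ (false ∷_))
  s₁ = Σᶜ (isNonzero ∘ g ∘ (true ∷_))
... | inj₁ e | inj₂ _ with schwartz-zippel (vanishing-half false p e)
...   | inj₁ e′ = inj₁ (halves≡0 false e e′)
...   | inj₂ v  = inj₂ (double-≤ (2 ℕ.^ suc n) k v (ℕₚ.m≤n+m _ (Σᶜ (isNonzero ∘ g ∘ (false ∷_)))))
schwartz-zippel {suc n} {suc k} {g} p
    | inj₂ _ | inj₁ e with schwartz-zippel (vanishing-half true p e)
...   | inj₁ e′ = inj₁ (halves≡0 true e e′)
...   | inj₂ v  = inj₂ (double-≤ (2 ℕ.^ suc n) k v (ℕₚ.m≤m+n _ (Σᶜ (isNonzero ∘ g ∘ (true ∷_)))))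

diff : Cube n → Cube n → Subset n
diff = zipWith _xor_

-- Stay in the half containing x if g is nonzero somewhere there; otherwise crossing over costs one
-- flip but lowers the degree by one.
nonzero-nearby : ∀ {n k} {g : Cube n → ℚ} → Deg< k g → ∀ x →
       (∀ y → g y ≡ 0ℚ) ⊎ (∃ λ y → size (diff x y) ℕ.< k × g y ≢ 0ℚ)
nonzero-nearby (vanish e) x = inj₁ e
nonzero-nearby {g = g} point [] with g [] ≟ 0ℚ
... | yes e = inj₁ λ { [] → e }
... | no e  = inj₂ ([] , s≤s z≤n , e)
nonzero-nearby {suc n} {suc k} {g} p (b ∷ x) with nonzero-nearby (Deg<-half b p) x
... | inj₂ (y , near , nz) = inj₂ (b ∷ y , subst (ℕ._< suc k) (sym (size-same b)) near , nz)
  where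
  size-same : ∀ b → size (diff (b ∷ x) (b ∷ y)) ≡ size (diff x y)
  size-same false = refl
  size-same true = refl
... | inj₁ e with nonzero-nearby (vanishing-half b p e) x
...   | inj₁ e′ = inj₁ (halves≡0 b e e′)
...   | inj₂ (y , near , nz) = inj₂ (not b ∷ y , subst (ℕ._< suc k) (sym (size-not b)) (s≤s near) , nz)
  where
  size-not : ∀ b → size (diff (b ∷ x) (not b ∷ y)) ≡ suc (size (diff x y))
  size-not false = refl
  size-not true = refl

-- Restrictions

-- As a function of the last argument this is a restriction. The fixed variables remain as dummies,
-- so all restrictions live on the same cube.
mux : Subset n → Cube n → Cube n → Cube n
mux [] [] [] = []
mux (s ∷ S) (a ∷ x) (b ∷ y) = (if s then a else b) ∷ mux S x y

_∘tail : (Cube n → ℚ) → Cube (suc n) → ℚ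
(g ∘tail) (_ ∷ x) = g x

∘tail-Deg< : Deg< k g → Deg< k (g ∘tail)
∘tail-Deg< (vanish e) = vanish λ { (_ ∷ x) → e x }
∘tail-Deg< {g = g} p@point = step p (Deg<-zero λ x → ℚₚ.+-inverseʳ (g x))
∘tail-Deg< {g = g} p@(step _ _) = step p (Deg<-zero λ x → ℚₚ.+-inverseʳ (g x))

mux-Deg< : ∀ {n k} {g : Cube n → ℚ} S z → Deg< k g → Deg< k (λ y → g (mux S z y))
mux-Deg< S z (vanish e) = vanish λ y → e _
mux-Deg< S z point = point
mux-Deg< (true ∷ S) (b ∷ z) p@(step _ _) =
  Deg<-resp (∘tail-Deg< (mux-Deg< S z (Deg<-half b p))) λ { (_ ∷ y) → refl }
mux-Deg< (false ∷ S) (b ∷ z) (step p q) = step (mux-Deg< S z p) (mux-Deg< S z q)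

halves-difference-Deg< : ∀ {g : Cube (suc n) → ℚ} b b′ → Deg< (suc k) g →
                         Deg< k (λ x → g (b ∷ x) - g (b′ ∷ x))
halves-difference-Deg< {g = g} false false p = Deg<-zero λ x → ℚₚ.+-inverseʳ (g (false ∷ x))
halves-difference-Deg< {g = g} true true p = Deg<-zero λ x → ℚₚ.+-inverseʳ (g (true ∷ x))
halves-difference-Deg< true false (step p q) = q
halves-difference-Deg< {g = g} false true (step p q) = Deg<-resp (Deg<-lincomb (- 1ℚ) 0ℚ q q) λ x →
  solve 2 (λ u v → con (- 1ℚ) :* (u :- v) :+ con 0ℚ :* (u :- v) := v :- u) refl
    (g (true ∷ x)) (g (false ∷ x))

-- Fixing variables changes only lower-order terms: a top-degree monomial in y comes from one that
-- avoids `S`, and its coefficient does not depend on the fixed values. The proof changes the fixed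
-- values one coordinate at a time and telescopes.
mux-difference-Deg< : ∀ {n k} {g : Cube n → ℚ} S z x → Deg< (suc k) g →
                      Deg< k (λ y → g (mux S z y) - g (mux S x y))
mux-difference-Deg< {g = g} [] [] [] point = Deg<-zero λ { [] → ℚₚ.+-inverseʳ (g []) }
mux-difference-Deg< {g = g} (true ∷ S) (b ∷ z) (b′ ∷ x) p@(step _ _) =
  Deg<-resp (∘tail-Deg< (Deg<-+ (mux-Deg< S z (halves-difference-Deg< b b′ p))
                                (mux-difference-Deg< S z x (Deg<-half b′ p))))
    λ { (_ ∷ y) → solve 3 (λ u v w → (u :- v) :+ (v :- w) := u :- w) refl
          (g (b ∷ mux S z y)) (g (b′ ∷ mux S z y)) (g (b′ ∷ mux S x y)) }
-- `step` yields only positive bounds, so for bound 0 the vanishing is checked on each half.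
mux-difference-Deg< {k = zero} {g} (false ∷ S) (_ ∷ z) (_ ∷ x) p@(step _ _) =
  vanish λ { (b ∷ y) → vanishes (mux-difference-Deg< S z x (Deg<-half b p)) y }
  where
  vanishes : ∀ {n} {h : Cube n → ℚ} → Deg< 0 h → ∀ y → h y ≡ 0ℚ
  vanishes (vanish e) = e
mux-difference-Deg< {k = suc k} {g} (false ∷ S) (_ ∷ z) (_ ∷ x) (step p q) =
  step (mux-difference-Deg< S z x p) (Deg<-resp (mux-difference-Deg< S z x q) λ y →
    solve 4 (λ a b c d → (a :- b) :- (c :- d) := (a :- c) :- (b :- d)) refl
      (g (true ∷ mux S z y)) (g (false ∷ mux S z y)) (g (true ∷ mux S x y)) (g (false ∷ mux S x y)))

-- A Markov-type inequality

-- damp g y is the multilinear extension of g at y/2, so a monomial of degree k is an eigenvector modulo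
-- lower degree, with eigenvalue 2^(-k).
damp : (Cube n → ℚ) → Cube n → ℚ
damp g [] = g []
damp g (false ∷ x) = damp (g ∘ (false ∷_)) x
damp g (true ∷ x) = ½ * (damp (g ∘ (false ∷_)) x + damp (g ∘ (true ∷_)) x)

damp-cong : ∀ {n} {g h : Cube n → ℚ} → g ≗ h → damp g ≗ damp h
damp-cong g≗h [] = g≗h []
damp-cong g≗h (false ∷ x) = damp-cong (λ y → g≗h (false ∷ y)) x
damp-cong g≗h (true ∷ x) = cong₂ (λ u v → ½ * (u + v))
  (damp-cong (λ y → g≗h (false ∷ y)) x) (damp-cong (λ y → g≗h (true ∷ y)) x)

damp-minus : ∀ {n} (g h : Cube n → ℚ) x → damp (λ y → g y - h y) x ≡ damp g x - damp h x
damp-minus g h [] = refl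
damp-minus g h (false ∷ x) = damp-minus (g ∘ (false ∷_)) (h ∘ (false ∷_)) x
damp-minus g h (true ∷ x) = trans
  (cong₂ (λ u v → ½ * (u + v)) (damp-minus (g ∘ (false ∷_)) (h ∘ (false ∷_)) x)
                               (damp-minus (g ∘ (true ∷_)) (h ∘ (true ∷_)) x))
  (solve 4 (λ a b c d → con ½ :* ((a :- b) :+ (c :- d)) := con ½ :* (a :+ c) :- con ½ :* (b :+ d)) refl
    (damp (g ∘ (false ∷_)) x) (damp (h ∘ (false ∷_)) x)
    (damp (g ∘ (true ∷_)) x) (damp (h ∘ (true ∷_)) x))

halve-double : ∀ M → ½ * (M + M) ≡ M
halve-double = solve 1 (λ M → con ½ :* (M :+ M) := M) refl

-- Each value of `damp g` is an average of values of g.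
damp-bounded : ∀ {n M} {g : Cube n → ℚ} → (∀ x → ∣ g x ∣ ≤ M) → ∀ x → ∣ damp g x ∣ ≤ M
damp-bounded le [] = le []
damp-bounded le (false ∷ x) = damp-bounded (λ y → le (false ∷ y)) x
damp-bounded {M = M} {g} le (true ∷ x) = begin
  ∣ ½ * (u + v) ∣      ≡⟨ ℚₚ.∣p*q∣≡∣p∣*∣q∣ ½ (u + v) ⟩
  ½ * ∣ u + v ∣        ≤⟨ ℚₚ.*-monoˡ-≤-nonNeg ½ (ℚₚ.≤-trans (ℚₚ.∣p+q∣≤∣p∣+∣q∣ u v)
                           (ℚₚ.+-mono-≤ (damp-bounded (λ y → le (false ∷ y)) x)
                                        (damp-bounded (λ y → le (true ∷ y)) x))) ⟩
  ½ * (M + M)          ≡⟨ halve-double M ⟩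
  M                    ∎
  where
  open ℚₚ.≤-Reasoning
  u = damp (g ∘ (false ∷_)) x
  v = damp (g ∘ (true ∷_)) x

0⃗ 1⃗ : Cube n
0⃗ = replicate _ false
1⃗ = replicate _ true

damp-0⃗ : ∀ {n} (g : Cube n → ℚ) → damp g 0⃗ ≡ g 0⃗
damp-0⃗ {zero} g = refl
damp-0⃗ {suc n} g = damp-0⃗ (g ∘ (false ∷_))

-- The sum of the coefficients of the linear monomials.
Λ : (Cube n → ℚ) → ℚ
Λ {zero} g = 0ℚ
Λ {suc n} g = δ g 0⃗ + Λ (g ∘ (false ∷_))

Λ-cong : ∀ {n} {g h : Cube n → ℚ} → g ≗ h → Λ g ≡ Λ h
Λ-cong {zero} g≗h = refl
Λ-cong {suc n} g≗h = cong₂ _+_ (cong₂ _-_ (g≗h _) (g≗h _)) (Λ-cong (λ x → g≗h (false ∷ x)))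

Λ-lincomb : ∀ {n} a b (g h : Cube n → ℚ) → Λ (λ x → a * g x + b * h x) ≡ a * Λ g + b * Λ h
Λ-lincomb {zero} a b g h =
  solve 2 (λ a b → con 0ℚ := a :* con 0ℚ :+ b :* con 0ℚ) refl a b
Λ-lincomb {suc n} a b g h = trans
  (cong (δ (λ x → a * g x + b * h x) 0⃗ +_)
    (Λ-lincomb a b (g ∘ (false ∷_)) (h ∘ (false ∷_))))
  (solve 8 (λ a b g₁ g₀ h₁ h₀ u v →
      ((a :* g₁ :+ b :* h₁) :- (a :* g₀ :+ b :* h₀)) :+ (a :* u :+ b :* v)
      := a :* ((g₁ :- g₀) :+ u) :+ b :* ((h₁ :- h₀) :+ v)) refl
    a b (g (true ∷ 0⃗)) (g (false ∷ 0⃗)) (h (true ∷ 0⃗)) (h (false ∷ 0⃗))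
    (Λ (g ∘ (false ∷_))) (Λ (h ∘ (false ∷_))))

-- Substituting y/2 halves each linear coefficient exactly, with no contribution from other degrees.
Λ-damp : ∀ {n} (g : Cube n → ℚ) → Λ (damp g) ≡ ½ * Λ g
Λ-damp {zero} g = refl
Λ-damp {suc n} g = trans
  (cong₂ _+_ (cong₂ (λ u v → ½ * (u + v) - u) (damp-0⃗ (g ∘ (false ∷_))) (damp-0⃗ (g ∘ (true ∷_))))
             (Λ-damp (g ∘ (false ∷_))))
  (solve 3 (λ u v w → con ½ :* (u :+ v) :- u :+ con ½ :* w := con ½ :* ((v :- u) :+ w)) refl
    (g (false ∷ 0⃗)) (g (true ∷ 0⃗)) (Λ (g ∘ (false ∷_))))

½^ : ℕ → ℚ
½^ zero = 1ℚ
½^ (suc k) = ½ * ½^ k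

Deg<1⇒constant : ∀ {n} {g : Cube n → ℚ} → Deg< 1 g → ∀ x y → g x ≡ g y
Deg<1⇒constant point [] [] = refl
Deg<1⇒constant {g = g} (step p (vanish e)) (b ∷ x) (c ∷ y) =
  trans (head-irrelevant b x) (trans (Deg<1⇒constant p x y) (sym (head-irrelevant c y)))
  where
  head-irrelevant : ∀ b x → g (b ∷ x) ≡ g (false ∷ x)
  head-irrelevant false x = refl
  head-irrelevant true x = trans
    (solve 2 (λ u v → u := (u :- v) :+ v) refl (g (true ∷ x)) (g (false ∷ x)))
    (trans (cong (_+ g (false ∷ x)) (e x)) (ℚₚ.+-identityˡ _))

damp-constant : ∀ {n} {g : Cube n → ℚ} c → (∀ x → g x ≡ c) → ∀ x → damp g x ≡ c
damp-constant c e [] = e []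
damp-constant c e (false ∷ x) = damp-constant c (λ y → e (false ∷ y)) x
damp-constant c e (true ∷ x) = trans
  (cong₂ (λ u v → ½ * (u + v)) (damp-constant c (λ y → e (false ∷ y)) x)
                               (damp-constant c (λ y → e (true ∷ y)) x)) (halve-double c)

-- The derivative of `damp g` is ½ times `damp (δ g)`, so each derivative taken contributes one
-- factor ½ to the eigenvalue, and the top-degree terms cancel.
damp-lowers-degree : ∀ {n k} {g : Cube n → ℚ} → Deg< (suc k) g → Deg< k (λ x → damp g x - ½^ k * g x)
damp-lowers-degree {k = zero} {g} p = vanish λ x →
  trans (cong (_- 1ℚ * g x) (damp-constant (g x) (λ y → Deg<1⇒constant p y x) x))
        (solve 1 (λ u → u :- con 1ℚ :* u := con 0ℚ) refl (g x))
damp-lowers-degree {k = suc k} point = point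
damp-lowers-degree {k = suc k} {g} (step p q) = step (damp-lowers-degree p)
  (Deg<-resp (Deg<-lincomb ½ 0ℚ (damp-lowers-degree q) (damp-lowers-degree q)) λ x → trans
    (cong (λ z → ½ * (z - ½^ k * δ g x) + 0ℚ * (z - ½^ k * δ g x))
      (damp-minus (g ∘ (true ∷_)) (g ∘ (false ∷_)) x))
    (solve 5 (λ t₁ t₀ c u v →
        con ½ :* ((t₁ :- t₀) :- c :* (u :- v)) :+ con 0ℚ :* ((t₁ :- t₀) :- c :* (u :- v))
        := (con ½ :* (t₀ :+ t₁) :- (con ½ :* c) :* u) :- (t₀ :- (con ½ :* c) :* v)) refl
      (damp (g ∘ (true ∷_)) x) (damp (g ∘ (false ∷_)) x) (½^ k) (g (true ∷ x)) (g (false ∷ x))))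

-- The increments of an affine function do not depend on the base point, so they telescope along a
-- path between the two corners.
Λ-affine : ∀ {n} {g : Cube n → ℚ} → Deg< 2 g → Λ g ≡ g 1⃗ - g 0⃗
Λ-affine {g = g} point = sym (ℚₚ.+-inverseʳ (g []))
Λ-affine {g = g} (step p q) = trans
  (cong₂ _+_ (Deg<1⇒constant q 0⃗ 1⃗) (Λ-affine p))
  (solve 3 (λ u v w → (u :- v) :+ (v :- w) := u :- w) refl
    (g (true ∷ 1⃗)) (g (false ∷ 1⃗)) (g (false ∷ 0⃗)))

4ℚ ¼ : ℚ
4ℚ = 1ℚ + 1ℚ + 1ℚ + 1ℚ
¼ = ½ * ½

0≤½^ : ∀ k → 0ℚ ≤ ½^ k
0≤½^ zero = toWitness {a? = 0ℚ ℚₚ.≤? 1ℚ} _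
0≤½^ (suc k) = ℚₚ.*-monoˡ-≤-nonNeg ½ (0≤½^ k)

½^≤1 : ∀ k → ½^ k ≤ 1ℚ
½^≤1 zero = ℚₚ.≤-refl
½^≤1 (suc k) = ℚₚ.≤-trans (ℚₚ.*-monoˡ-≤-nonNeg ½ (½^≤1 k)) (toWitness {a? = ½ ℚₚ.≤? 1ℚ} _)

½^≤¼ : ∀ k → ½^ (2 ℕ.+ k) ≤ ¼
½^≤¼ k = ℚₚ.*-monoˡ-≤-nonNeg ½ (ℚₚ.*-monoˡ-≤-nonNeg ½ (½^≤1 k))

p≤∣p∣ : ∀ p → p ≤ ∣ p ∣
p≤∣p∣ p with ℚₚ.≤-total 0ℚ p
... | inj₁ 0≤p = ℚₚ.≤-reflexive (sym (ℚₚ.0≤p⇒∣p∣≡p 0≤p))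
... | inj₂ p≤0 = ℚₚ.≤-trans p≤0 (ℚₚ.0≤∣p∣ p)

-- The constants in 4·damp g - 4c·g make both estimates uniform in k ≥ 2.
rescaled : ℚ → (Cube n → ℚ) → Cube n → ℚ
rescaled c g x = 4ℚ * damp g x + (- (4ℚ * c)) * g x

rescaled-Deg< : ∀ {n k} {g : Cube n → ℚ} → Deg< (suc k) g → Deg< k (rescaled (½^ k) g)
rescaled-Deg< {k = k} {g} p =
  Deg<-resp (Deg<-lincomb 4ℚ 0ℚ (damp-lowers-degree p) (damp-lowers-degree p)) λ x →
    solve 3 (λ t c u → con 4ℚ :* (t :- c :* u) :+ con 0ℚ :* (t :- c :* u)
                    := con 4ℚ :* t :+ (:- (con 4ℚ :* c)) :* u) refl (damp g x) (½^ k) (g x)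

-- The damped term contributes 4 and the other at most 4c ≤ 1; this is the source of the base 5.
rescaled-bounded : ∀ {n M c} {g : Cube n → ℚ} → 0ℚ ≤ c → c ≤ ¼ →
                   (∀ x → ∣ g x ∣ ≤ M) → ∀ x → ∣ rescaled c g x ∣ ≤ 5 · M
rescaled-bounded {M = M} {c} {g} 0≤c c≤¼ le x = begin
  ∣ 4ℚ * damp g x + (- (4ℚ * c)) * g x ∣          ≤⟨ ℚₚ.∣p+q∣≤∣p∣+∣q∣ (4ℚ * damp g x) ((- (4ℚ * c)) * g x) ⟩
  ∣ 4ℚ * damp g x ∣ + ∣ (- (4ℚ * c)) * g x ∣      ≡⟨ cong₂ _+_ (ℚₚ.∣p*q∣≡∣p∣*∣q∣ 4ℚ (damp g x)) (ℚₚ.∣p*q∣≡∣p∣*∣q∣ (- (4ℚ * c)) (g x)) ⟩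
  4ℚ * ∣ damp g x ∣ + ∣ - (4ℚ * c) ∣ * ∣ g x ∣    ≡⟨ cong (λ z → 4ℚ * ∣ damp g x ∣ + z * ∣ g x ∣)
                                                      (trans (ℚₚ.∣-p∣≡∣p∣ (4ℚ * c)) (ℚₚ.0≤p⇒∣p∣≡p (ℚₚ.*-monoˡ-≤-nonNeg 4ℚ 0≤c))) ⟩
  4ℚ * ∣ damp g x ∣ + (4ℚ * c) * ∣ g x ∣          ≤⟨ ℚₚ.+-mono-≤ (ℚₚ.*-monoˡ-≤-nonNeg 4ℚ (damp-bounded le x)) small ⟩
  4ℚ * M + M                                      ≡⟨ solve 1 (λ M → con 4ℚ :* M :+ M := M :+ (M :+ (M :+ (M :+ (M :+ con 0ℚ))))) refl M ⟩
  5 · M                                           ∎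
  where
  open ℚₚ.≤-Reasoning
  small : (4ℚ * c) * ∣ g x ∣ ≤ M
  small = begin
    (4ℚ * c) * ∣ g x ∣   ≤⟨ ℚₚ.*-monoʳ-≤-nonNeg ∣ g x ∣ {{ℚₚ.∣-∣-nonNeg (g x)}} (ℚₚ.*-monoˡ-≤-nonNeg 4ℚ c≤¼) ⟩
    1ℚ * ∣ g x ∣         ≡⟨ ℚₚ.*-identityˡ ∣ g x ∣ ⟩
    ∣ g x ∣              ≤⟨ le x ⟩
    M                    ∎

-- Rescaling multiplies `Λ` by 4·½ - 4c = 2 - 4c, which is at least 1.
∣Λ∣≤∣Λ-rescaled∣ : ∀ {n c} (g : Cube n → ℚ) → c ≤ ¼ → ∣ Λ g ∣ ≤ ∣ Λ (rescaled c g) ∣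
∣Λ∣≤∣Λ-rescaled∣ {c = c} g c≤¼ = begin
  ∣ Λ g ∣                                  ≡⟨ ℚₚ.*-identityˡ ∣ Λ g ∣ ⟨
  1ℚ * ∣ Λ g ∣                             ≤⟨ ℚₚ.*-monoʳ-≤-nonNeg ∣ Λ g ∣ {{ℚₚ.∣-∣-nonNeg (Λ g)}}
                                                (ℚₚ.≤-trans 1≤factor (p≤∣p∣ _)) ⟩
  ∣ 1ℚ + 1ℚ + - (4ℚ * c) ∣ * ∣ Λ g ∣       ≡⟨ ℚₚ.∣p*q∣≡∣p∣*∣q∣ (1ℚ + 1ℚ + - (4ℚ * c)) (Λ g) ⟨
  ∣ (1ℚ + 1ℚ + - (4ℚ * c)) * Λ g ∣         ≡⟨ cong ∣_∣ (solve 2 (λ c l →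
                                                (con 1ℚ :+ con 1ℚ :+ (:- (con 4ℚ :* c))) :* l
                                                := con 4ℚ :* (con ½ :* l) :+ (:- (con 4ℚ :* c)) :* l) refl c (Λ g)) ⟩
  ∣ 4ℚ * (½ * Λ g) + (- (4ℚ * c)) * Λ g ∣  ≡⟨ cong (λ z → ∣ 4ℚ * z + (- (4ℚ * c)) * Λ g ∣) (Λ-damp g) ⟨
  ∣ 4ℚ * Λ (damp g) + (- (4ℚ * c)) * Λ g ∣ ≡⟨ cong ∣_∣ (Λ-lincomb 4ℚ (- (4ℚ * c)) (damp g) g) ⟨
  ∣ Λ (rescaled c g) ∣                     ∎
  where
  open ℚₚ.≤-Reasoning
  1≤factor : 1ℚ ≤ 1ℚ + 1ℚ + - (4ℚ * c)
  1≤factor = ℚₚ.+-monoʳ-≤ (1ℚ + 1ℚ) (ℚₚ.neg-antimono-≤ (ℚₚ.*-monoˡ-≤-nonNeg 4ℚ c≤¼))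

·-nonneg : ∀ k {M} → 0ℚ ≤ M → 0ℚ ≤ k · M
·-nonneg zero 0≤M = ℚₚ.≤-refl
·-nonneg (suc k) 0≤M = ℚₚ.+-mono-≤ 0≤M (·-nonneg k 0≤M)

-- Each rescaling lowers the degree by one, multiplies the bound by at most 5 and does not decrease
-- the absolute value of `Λ`.
Λ-bound : ∀ {n} k {M} {g : Cube n → ℚ} → Deg< (suc k) g → (∀ x → ∣ g x ∣ ≤ M) →
          ∣ Λ g ∣ ≤ (5 ℕ.^ k) · M
Λ-bound zero {M} {g} p le = begin
  ∣ Λ g ∣           ≡⟨ cong ∣_∣ (Λ-affine (Deg<-suc p)) ⟩
  ∣ g 1⃗ - g 0⃗ ∣     ≡⟨ cong (λ z → ∣ z - g 0⃗ ∣) (Deg<1⇒constant p 1⃗ 0⃗) ⟩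
  ∣ g 0⃗ - g 0⃗ ∣     ≡⟨ cong ∣_∣ (ℚₚ.+-inverseʳ (g 0⃗)) ⟩
  0ℚ                ≤⟨ ·-nonneg 1 (ℚₚ.≤-trans (ℚₚ.0≤∣p∣ (g 0⃗)) (le 0⃗)) ⟩
  1 · M             ∎
  where open ℚₚ.≤-Reasoning
-- In degree one the eigenvalue is ½, and rescaling would annihilate `Λ`; the affine case is
-- therefore treated directly.
Λ-bound (suc zero) {M} {g} p le = begin
  ∣ Λ g ∣             ≡⟨ cong ∣_∣ (Λ-affine p) ⟩
  ∣ g 1⃗ - g 0⃗ ∣       ≤⟨ ℚₚ.∣p-q∣≤∣p∣+∣q∣ (g 1⃗) (g 0⃗) ⟩
  ∣ g 1⃗ ∣ + ∣ g 0⃗ ∣   ≤⟨ ℚₚ.+-mono-≤ (le 1⃗) (le 0⃗) ⟩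
  M + M               ≡⟨ cong (M +_) (ℚₚ.+-identityʳ M) ⟨
  M + (M + 0ℚ)        ≤⟨ ℚₚ.+-monoʳ-≤ M (ℚₚ.+-monoʳ-≤ M (·-nonneg 3 (ℚₚ.≤-trans (ℚₚ.0≤∣p∣ (g 0⃗)) (le 0⃗)))) ⟩
  5 · M               ∎
  where open ℚₚ.≤-Reasoning
Λ-bound (suc (suc j)) {M} {g} p le = begin
  ∣ Λ g ∣                             ≤⟨ ∣Λ∣≤∣Λ-rescaled∣ g (½^≤¼ j) ⟩
  ∣ Λ (rescaled (½^ (2 ℕ.+ j)) g) ∣   ≤⟨ Λ-bound (suc j) (rescaled-Deg< p)
                                           (rescaled-bounded (0≤½^ (2 ℕ.+ j)) (½^≤¼ j) le) ⟩
  (5 ℕ.^ suc j) · (5 · M)             ≡⟨ ×-assocˡ M (5 ℕ.^ suc j) 5 ⟩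
  (5 ℕ.^ suc j ℕ.* 5) · M             ≡⟨ cong (_· M) (ℕₚ.*-comm (5 ℕ.^ suc j) 5) ⟩
  (5 ℕ.^ (2 ℕ.+ j)) · M               ∎
  where open ℚₚ.≤-Reasoning

-- Small certificates

mux-∁ : ∀ {n} S (x y : Cube n) → mux (∁ S) x y ≡ mux S y x
mux-∁ [] [] [] = refl
mux-∁ (true ∷ S) (a ∷ x) (b ∷ y) = cong (b ∷_) (mux-∁ S x y)
mux-∁ (false ∷ S) (a ∷ x) (b ∷ y) = cong (a ∷_) (mux-∁ S x y)

mux-idem : ∀ {n} S (x : Cube n) → mux S x x ≡ x
mux-idem [] [] = refl
mux-idem (true ∷ S) (a ∷ x) = cong (a ∷_) (mux-idem S x)
mux-idem (false ∷ S) (a ∷ x) = cong (a ∷_) (mux-idem S x)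

-- Off `S` the point carries w or x, and these agree off `diff x w`, so resetting the remaining
-- coordinates to x changes nothing. This maintains `σ-off` when a block is added.
mux-absorbs : ∀ {n} S (x w z : Cube n) b → let v = if b then w else x in
              mux (∁ (S ∪ diff x w)) x (mux (∁ S) v z) ≡ mux (∁ S) v z
mux-absorbs [] [] [] [] false = refl
mux-absorbs [] [] [] [] true = refl
mux-absorbs (true ∷ S) (_ ∷ x) (_ ∷ w) (c ∷ z) false = cong (c ∷_) (mux-absorbs S x w z false)
mux-absorbs (true ∷ S) (_ ∷ x) (_ ∷ w) (c ∷ z) true = cong (c ∷_) (mux-absorbs S x w z true)
mux-absorbs (false ∷ S) (a ∷ x) (b ∷ w) (_ ∷ z) false with a xor b
... | true  = cong (a ∷_) (mux-absorbs S x w z false)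
... | false = cong (a ∷_) (mux-absorbs S x w z false)
mux-absorbs (false ∷ S) (true ∷ x) (true ∷ w) (_ ∷ z) true = cong (true ∷_) (mux-absorbs S x w z true)
mux-absorbs (false ∷ S) (true ∷ x) (false ∷ w) (_ ∷ z) true = cong (false ∷_) (mux-absorbs S x w z true)
mux-absorbs (false ∷ S) (false ∷ x) (true ∷ w) (_ ∷ z) true = cong (true ∷_) (mux-absorbs S x w z true)
mux-absorbs (false ∷ S) (false ∷ x) (false ∷ w) (_ ∷ z) true = cong (false ∷_) (mux-absorbs S x w z true)

·-neg : ∀ k q → k · (- q) ≡ - (k · q)
·-neg zero q = refl
·-neg (suc k) q = trans (cong (- q +_) (·-neg k q)) (sym (ℚₚ.neg-distrib-+ q (k · q)))

·-∣∣ : ∀ k q → k · ∣ q ∣ ≤ ∣ k · q ∣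
·-∣∣ k q with ℚₚ.∣p∣≡p∨∣p∣≡-p q
... | inj₁ e = subst (λ z → k · z ≤ ∣ k · q ∣) (sym e) (p≤∣p∣ (k · q))
... | inj₂ e = subst (λ z → k · z ≤ ∣ k · q ∣) (sym e)
  (subst₂ _≤_ (sym (·-neg k q)) (ℚₚ.∣-p∣≡∣p∣ (k · q)) (p≤∣p∣ (- (k · q))))

·-monoˡ-< : ∀ {k l M} → 0ℚ < M → k ℕ.< l → k · M < l · M
·-monoˡ-< {zero} {suc l} 0<M _ = ℚₚ.+-mono-<-≤ 0<M (·-nonneg l (ℚₚ.<⇒≤ 0<M))
·-monoˡ-< {suc k} {suc l} {M} 0<M (s≤s k<l) = ℚₚ.+-monoʳ-< M (·-monoˡ-< 0<M k<l)

·-cancel-≤ : ∀ {k l M} → 0ℚ < M → k · M ≤ l · M → k ℕ.≤ l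
·-cancel-≤ 0<M le = ℕₚ.≮⇒≥ λ l<k → ℚₚ.<-irrefl refl (ℚₚ.<-≤-trans (·-monoˡ-< 0<M l<k) le)

≢0⇒0<∣∣ : ∀ {q} → q ≢ 0ℚ → 0ℚ < ∣ q ∣
≢0⇒0<∣∣ {q} q≢0 = ℚₚ.≰⇒> λ le → q≢0 (ℚₚ.∣p∣≡0⇒p≡0 q (ℚₚ.≤-antisym le (ℚₚ.0≤∣p∣ q)))

∣p∪q∣≤∣p∣+∣q∣ : ∀ {n} (p q : Subset n) → size (p ∪ q) ℕ.≤ size p ℕ.+ size q
∣p∪q∣≤∣p∣+∣q∣ [] [] = z≤n
∣p∪q∣≤∣p∣+∣q∣ (true ∷ p) (true ∷ q) =
  s≤s (ℕₚ.≤-trans (∣p∪q∣≤∣p∣+∣q∣ p q) (ℕₚ.+-monoʳ-≤ (size p) (ℕₚ.n≤1+n (size q))))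
∣p∪q∣≤∣p∣+∣q∣ (true ∷ p) (false ∷ q) = s≤s (∣p∪q∣≤∣p∣+∣q∣ p q)
∣p∪q∣≤∣p∣+∣q∣ (false ∷ p) (true ∷ q) =
  ℕₚ.≤-trans (s≤s (∣p∪q∣≤∣p∣+∣q∣ p q)) (ℕₚ.≤-reflexive (sym (ℕₚ.+-suc (size p) (size q))))
∣p∪q∣≤∣p∣+∣q∣ (false ∷ p) (false ∷ q) = ∣p∪q∣≤∣p∣+∣q∣ p q

module Certificate {n d : ℕ} {p r : Cube n → ℚ}
  (p-deg : Deg< (suc d) p) (r-deg : Deg< (suc d) r) (r≢0⇒p≡0 : ∀ y → r y ≢ 0ℚ → p y ≡ 0ℚ)
  (x : Cube n) (px≢0 : p x ≢ 0ℚ) (max : ∀ y → ∣ p y ∣ ≤ ∣ p x ∣) where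

  -- s disjoint blocks with union S, flipped independently around x by σ. That flipping any single one
  -- of them makes p vanish is recorded only through Λσ.
  record Blocks (s : ℕ) : Set where
    field
      S      : Subset n
      S-size : size S ℕ.≤ s ℕ.* d
      σ      : Cube s → Cube n
      σ-Deg< : ∀ {k} {g : Cube n → ℚ} → Deg< k g → Deg< k (g ∘ σ)
      σ-off  : ∀ y → mux (∁ S) x (σ y) ≡ σ y
      σ-0⃗    : σ 0⃗ ≡ x
      Λσ     : Λ (p ∘ σ) ≡ s · (- p x)

  open Blocks

  no-blocks : Blocks 0
  no-blocks = record
    { S = ⊥ ; S-size = ℕₚ.≤-reflexive (∣⊥∣≡0 n) ; σ = λ _ → x
    ; σ-Deg< = λ { {zero} (vanish e) → vanish λ _ → e x ; {suc k} _ → point }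
    ; σ-off = λ _ → mux-idem (∁ ⊥) x ; σ-0⃗ = refl ; Λσ = refl }

  -- The new block is the part of `diff x w` outside the old `S`, hence disjoint from the earlier
  -- blocks. Flipping it alone makes r nonzero and p zero, so its linear coefficient is 0 - p x.
  add-block : ∀ {s} (B : Blocks s) w → size (diff x w) ℕ.≤ d → r (mux (S B) x w) ≢ 0ℚ → Blocks (suc s)
  add-block {s} B w near rw≢0 = record
    { S = S B ∪ diff x w
    ; S-size = ℕₚ.≤-trans (∣p∪q∣≤∣p∣+∣q∣ (S B) (diff x w))
                 (ℕₚ.≤-trans (ℕₚ.+-mono-≤ (S-size B) near) (ℕₚ.≤-reflexive (ℕₚ.+-comm (s ℕ.* d) d)))
    ; σ = σ′
    ; σ-Deg< = deg
    ; σ-off = λ { (b ∷ y) → mux-absorbs (S B) x w (σ B y) b }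
    ; σ-0⃗ = trans (σ-off B 0⃗) (σ-0⃗ B)
    ; Λσ = cong₂ _+_
        (trans (cong₂ _-_ p-flipped (cong p (trans (σ-off B 0⃗) (σ-0⃗ B)))) (ℚₚ.+-identityˡ (- p x)))
        (trans (Λ-cong λ y → cong p (σ-off B y)) (Λσ B)) }
    where
    σ′ : Cube (suc s) → Cube n
    σ′ (b ∷ y) = mux (∁ (S B)) (if b then w else x) (σ B y)

    deg : ∀ {k} {g : Cube n → ℚ} → Deg< k g → Deg< k (g ∘ σ′)
    deg (vanish e) = vanish (λ y → e (σ′ y))
    -- The derivative in the block variable is a difference of two restrictions of the same
    -- coordinates, so flipping a whole block at once does not raise the degree.
    deg {suc k} p = step (σ-Deg< B (mux-Deg< (∁ (S B)) x p))
                         (σ-Deg< B (mux-difference-Deg< (∁ (S B)) w x p))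

    p-flipped : p (σ′ (true ∷ 0⃗)) ≡ 0ℚ
    p-flipped = trans (cong p (trans (cong (mux (∁ (S B)) w) (σ-0⃗ B)) (mux-∁ (S B) w x)))
                      (r≢0⇒p≡0 _ rw≢0)

  -- The s linear coefficients all equal - p x, with no cancellation, while p x bounds p along `σ`
  -- in absolute value; the Markov-type bound then limits s.
  few-blocks : ∀ {s} → Blocks s → s ℕ.≤ 5 ℕ.^ d
  few-blocks {s} B = ·-cancel-≤ (≢0⇒0<∣∣ px≢0) (begin
    s · ∣ p x ∣          ≡⟨ cong (s ·_) (ℚₚ.∣-p∣≡∣p∣ (p x)) ⟨
    s · ∣ - p x ∣        ≤⟨ ·-∣∣ s (- p x) ⟩
    ∣ s · (- p x) ∣      ≡⟨ cong ∣_∣ (Λσ B) ⟨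
    ∣ Λ (p ∘ σ B) ∣      ≤⟨ Λ-bound d (σ-Deg< B p-deg) (λ y → max (σ B y)) ⟩
    (5 ℕ.^ d) · ∣ p x ∣  ∎)
    where open ℚₚ.≤-Reasoning

  -- If r does not vanish with `S` fixed as in x, a nonzero value near x supplies another block. The
  -- fuel exceeds the number of blocks still possible, so it cannot run out.
  greedy : ∀ fuel {s} → 5 ℕ.^ d ℕ.< fuel ℕ.+ s → Blocks s →
           ∃ λ S → size S ℕ.≤ 5 ℕ.^ d ℕ.* d × (∀ y → r (mux S x y) ≡ 0ℚ)
  greedy zero many B = contradiction (few-blocks B) (ℕₚ.<⇒≱ many)
  greedy (suc fuel) {s} many B with nonzero-nearby (mux-Deg< (S B) x r-deg) x
  ... | inj₁ e = S B , ℕₚ.≤-trans (S-size B) (ℕₚ.*-monoˡ-≤ d (few-blocks B)) , e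
  ... | inj₂ (w , near , rw≢0) =
    greedy fuel (subst (5 ℕ.^ d ℕ.<_) (sym (ℕₚ.+-suc fuel s)) many) (add-block B w (ℕ.s≤s⁻¹ near) rw≢0)

  certificate : ∃ λ S → size S ℕ.≤ 5 ℕ.^ d ℕ.* d × (∀ y → r (mux S x y) ≡ 0ℚ)
  certificate = greedy (suc (5 ℕ.^ d)) (ℕₚ.m≤m+n _ 0) no-blocks

-- Influence and sensitivity

Σᶜ-cong : ∀ {n} {F G : Cube n → ℕ} → F ≗ G → Σᶜ F ≡ Σᶜ G
Σᶜ-cong {zero} e = e []
Σᶜ-cong {suc n} e = cong₂ ℕ._+_ (Σᶜ-cong λ x → e (false ∷ x)) (Σᶜ-cong λ x → e (true ∷ x))

Σᶜ-const : ∀ n c → Σᶜ {n} (λ _ → c) ≡ 2 ℕ.^ n ℕ.* c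
Σᶜ-const zero c = sym (ℕₚ.+-identityʳ c)
Σᶜ-const (suc n) c rewrite Σᶜ-const n c = double (2 ℕ.^ n) c
  where
  double : ∀ a c → a ℕ.* c ℕ.+ a ℕ.* c ≡ (a ℕ.+ (a ℕ.+ 0)) ℕ.* c
  double = ℕ-Ring.solve-∀

interchange : ∀ a b c d → (a ℕ.+ b) ℕ.+ (c ℕ.+ d) ≡ (a ℕ.+ c) ℕ.+ (b ℕ.+ d)
interchange = ℕ-Ring.solve-∀

Σᶜ-+ : ∀ {n} (F G : Cube n → ℕ) → Σᶜ (λ x → F x ℕ.+ G x) ≡ Σᶜ F ℕ.+ Σᶜ G
Σᶜ-+ {zero} F G = refl
Σᶜ-+ {suc n} F G = trans
  (cong₂ ℕ._+_ (Σᶜ-+ (F ∘ (false ∷_)) (G ∘ (false ∷_))) (Σᶜ-+ (F ∘ (true ∷_)) (G ∘ (true ∷_))))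
  (interchange (Σᶜ (F ∘ (false ∷_))) (Σᶜ (G ∘ (false ∷_))) (Σᶜ (F ∘ (true ∷_))) (Σᶜ (G ∘ (true ∷_))))

-- Mixing two independent uniform points gives a uniform point: each point arises from exactly 2^n
-- pairs.
Σᶜ-mux : ∀ {n} S (F : Cube n → ℕ) → Σᶜ (λ z → Σᶜ (λ y → F (mux S z y))) ≡ 2 ℕ.^ n ℕ.* Σᶜ F
Σᶜ-mux [] F = sym (ℕₚ.+-identityʳ (F []))
Σᶜ-mux {suc n} (true ∷ S) F = trans
  (cong₂ ℕ._+_ (trans (Σᶜ-+ A₀ A₀) (cong₂ ℕ._+_ e₀ e₀)) (trans (Σᶜ-+ A₁ A₁) (cong₂ ℕ._+_ e₁ e₁)))
  (arrange (2 ℕ.^ n) (Σᶜ (F ∘ (false ∷_))) (Σᶜ (F ∘ (true ∷_))))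
  where
  A₀ A₁ : Cube n → ℕ
  A₀ z = Σᶜ (λ y → F (false ∷ mux S z y))
  A₁ z = Σᶜ (λ y → F (true ∷ mux S z y))
  e₀ = Σᶜ-mux S (F ∘ (false ∷_))
  e₁ = Σᶜ-mux S (F ∘ (true ∷_))
  arrange : ∀ N a b → (N ℕ.* a ℕ.+ N ℕ.* a) ℕ.+ (N ℕ.* b ℕ.+ N ℕ.* b) ≡ (N ℕ.+ (N ℕ.+ 0)) ℕ.* (a ℕ.+ b)
  arrange = ℕ-Ring.solve-∀
Σᶜ-mux {suc n} (false ∷ S) F = trans
  (cong₂ ℕ._+_ e e)
  (arrange (2 ℕ.^ n) (Σᶜ (F ∘ (false ∷_))) (Σᶜ (F ∘ (true ∷_))))
  where
  A₀ A₁ : Cube n → ℕ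
  A₀ z = Σᶜ (λ y → F (false ∷ mux S z y))
  A₁ z = Σᶜ (λ y → F (true ∷ mux S z y))
  e = trans (Σᶜ-+ A₀ A₁) (cong₂ ℕ._+_ (Σᶜ-mux S (F ∘ (false ∷_))) (Σᶜ-mux S (F ∘ (true ∷_))))
  arrange : ∀ N a b → (N ℕ.* a ℕ.+ N ℕ.* b) ℕ.+ (N ℕ.* a ℕ.+ N ℕ.* b) ≡ (N ℕ.+ (N ℕ.+ 0)) ℕ.* (a ℕ.+ b)
  arrange = ℕ-Ring.solve-∀

differ : Bool → Bool → ℕ
differ a b = if a xor b then 1 else 0

differ≤1 : ∀ a b → differ a b ℕ.≤ 1
differ≤1 a b with a xor b
... | true  = s≤s z≤n
... | false = z≤n

sensitivity : BoolFun n → Cube n → ℕ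
sensitivity f x = sum (λ i → differ (f x) (f (flipAt x i)))

-- Each coordinate in `S` contributes at most 1; every other coordinate is sensitive for f exactly
-- when it is for the restriction.
sensitivity-mux : ∀ {n} (f : BoolFun n) S z y →
  sensitivity f (mux S z y) ℕ.≤ size S ℕ.+ sensitivity (f ∘ mux S z) y
sensitivity-mux f [] [] [] = z≤n
sensitivity-mux f (true ∷ S) (b ∷ z) (_ ∷ y) =
  ℕₚ.+-mono-≤ (differ≤1 (f (b ∷ mux S z y)) (f (not b ∷ mux S z y)))
    (ℕₚ.≤-trans (sensitivity-mux (f ∘ (b ∷_)) S z y) (ℕₚ.+-monoʳ-≤ (size S) (ℕₚ.m≤n+m _ _)))
sensitivity-mux f (false ∷ S) (_ ∷ z) (b ∷ y) = begin
  D ℕ.+ sensitivity (f ∘ (b ∷_)) (mux S z y)            ≤⟨ ℕₚ.+-monoʳ-≤ D (sensitivity-mux (f ∘ (b ∷_)) S z y) ⟩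
  D ℕ.+ (size S ℕ.+ sensitivity (f ∘ (b ∷_) ∘ mux S z) y)  ≡⟨ swap D (size S) _ ⟩
  size S ℕ.+ (D ℕ.+ sensitivity (f ∘ (b ∷_) ∘ mux S z) y)  ∎
  where
  open ℕₚ.≤-Reasoning
  D = differ (f (b ∷ mux S z y)) (f (not b ∷ mux S z y))
  swap : ∀ a b c → a ℕ.+ (b ℕ.+ c) ≡ b ℕ.+ (a ℕ.+ c)
  swap = ℕ-Ring.solve-∀

totalSensitivity : BoolFun n → ℕ
totalSensitivity f = Σᶜ (sensitivity f)

-- The pointwise bound is summed over all pairs z, y, and the multiplicity 2^n is cancelled.
totalSensitivity-mux : ∀ {n} (f : BoolFun n) S B → (∀ z → totalSensitivity (f ∘ mux S z) ℕ.≤ B) →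
  totalSensitivity f ℕ.≤ 2 ℕ.^ n ℕ.* size S ℕ.+ B
totalSensitivity-mux {n} f S B le = ℕₚ.*-cancelˡ-≤ (2 ℕ.^ n) {{ℕₚ.m^n≢0 2 n}} (begin
  2 ℕ.^ n ℕ.* totalSensitivity f
    ≡⟨ Σᶜ-mux S (sensitivity f) ⟨
  Σᶜ (λ z → Σᶜ (λ y → sensitivity f (mux S z y)))
    ≤⟨ Σᶜ-mono (λ z → Σᶜ-mono (λ y → sensitivity-mux f S z y)) ⟩
  Σᶜ (λ z → Σᶜ (λ y → size S ℕ.+ sensitivity (f ∘ mux S z) y))
    ≡⟨ Σᶜ-cong (λ z → trans (Σᶜ-+ (λ _ → size S) (sensitivity (f ∘ mux S z)))
                            (cong (ℕ._+ totalSensitivity (f ∘ mux S z)) (Σᶜ-const n (size S)))) ⟩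
  Σᶜ (λ z → 2 ℕ.^ n ℕ.* size S ℕ.+ totalSensitivity (f ∘ mux S z))
    ≤⟨ Σᶜ-mono (λ z → ℕₚ.+-monoʳ-≤ (2 ℕ.^ n ℕ.* size S) (le z)) ⟩
  Σᶜ {n} (λ _ → 2 ℕ.^ n ℕ.* size S ℕ.+ B)
    ≡⟨ Σᶜ-const n _ ⟩
  2 ℕ.^ n ℕ.* (2 ℕ.^ n ℕ.* size S ℕ.+ B)
    ∎)
  where open ℕₚ.≤-Reasoning

sum-zero : ∀ n {F : Fin n → ℕ} → (∀ i → F i ≡ 0) → sum F ≡ 0
sum-zero zero e = refl
sum-zero (suc n) e = cong₂ ℕ._+_ (e zero) (sum-zero n (e ∘ suc))

constant⇒totalSensitivity≡0 : ∀ {n} (f : BoolFun n) b → (∀ x → f x ≡ b) → totalSensitivity f ≡ 0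
constant⇒totalSensitivity≡0 {n} f b e = trans
  (Σᶜ-cong λ x → sum-zero n λ i → trans (cong₂ differ (e x) (e (flipAt x i))) (differ-same b))
  (trans (Σᶜ-const n 0) (ℕₚ.*-zeroʳ (2 ℕ.^ n)))
  where
  differ-same : ∀ b → differ b b ≡ 0
  differ-same false = refl
  differ-same true = refl

influence : BoolFun n → Fin n → ℕ
influence f i = Σᶜ (λ x → differ (f x) (f (flipAt x i)))

Σᶜ-sum : ∀ {n} m (F : Cube n → Fin m → ℕ) → Σᶜ (λ x → sum (F x)) ≡ sum (λ i → Σᶜ (λ x → F x i))
Σᶜ-sum {n} zero F = trans (Σᶜ-const n 0) (ℕₚ.*-zeroʳ (2 ℕ.^ n))
Σᶜ-sum (suc m) F = trans (Σᶜ-+ (λ x → F x zero) (λ x → sum (F x ∘ suc)))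
  (cong (Σᶜ (λ x → F x zero) ℕ.+_) (Σᶜ-sum m (λ x → F x ∘ suc)))

sum-lower-bound : ∀ m {a c} (F : Fin m → ℕ) → (∀ i → a ℕ.≤ c ℕ.* F i) → m ℕ.* a ℕ.≤ c ℕ.* sum F
sum-lower-bound zero F le = z≤n
sum-lower-bound (suc m) {a} {c} F le = ℕₚ.≤-trans
  (ℕₚ.+-mono-≤ (le zero) (sum-lower-bound m {a} {c} (F ∘ suc) (λ i → le (suc i))))
  (ℕₚ.≤-reflexive (sym (ℕₚ.*-distribˡ-+ c (F zero) (sum (F ∘ suc)))))

-- Total sensitivity via repeated certificates

argmax : ∀ {n} (F : Cube n → ℚ) → ∃ λ x → ∀ y → F y ≤ F x
argmax {zero} F = [] , λ { [] → ℚₚ.≤-refl }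
argmax {suc n} F with argmax (F ∘ (false ∷_)) | argmax (F ∘ (true ∷_))
... | x₀ , m₀ | x₁ , m₁ with ℚₚ.≤-total (F (false ∷ x₀)) (F (true ∷ x₁))
...   | inj₁ le = true ∷ x₁ , λ { (false ∷ y) → ℚₚ.≤-trans (m₀ y) le ; (true ∷ y) → m₁ y }
...   | inj₂ ge = false ∷ x₀ , λ { (false ∷ y) → m₀ y ; (true ∷ y) → ℚₚ.≤-trans (m₁ y) ge }

-- This form of the representation, with r in the role of q - p, passes to restrictions by
-- composition.
Separates : (p r : Cube n → ℚ) → BoolFun n → Set
Separates p r f = ∀ x → (f x ≡ true × p x ≢ 0ℚ × r x ≡ 0ℚ) ⊎ (f x ≡ false × p x ≡ 0ℚ × r x ≢ 0ℚ)

certificateSize : ℕ → ℕ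
certificateSize d = 5 ℕ.^ d ℕ.* d

-- Here k is the current degree bound for r and falls with each round, while d stays fixed and
-- controls the certificate size. Each round adds one certificate size to the average sensitivity.
totalSensitivity-bound : ∀ {n d} k {f : BoolFun n} {p r : Cube n → ℚ} → Separates p r f →
  Deg< (suc d) p → Deg< (suc d) r → Deg< k r →
  totalSensitivity f ℕ.≤ 2 ℕ.^ n ℕ.* (k ℕ.* certificateSize d)
totalSensitivity-bound {n} {d} zero {f} {p} {r} sep p-deg r-deg (vanish e) =
  ℕₚ.≤-trans (ℕₚ.≤-reflexive (constant⇒totalSensitivity≡0 f true is-true)) z≤n
  where
  is-true : ∀ x → f x ≡ true
  is-true x with sep x
  ... | inj₁ (fx , _) = fx
  ... | inj₂ (_ , _ , rx≢0) = contradiction (e x) rx≢0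
totalSensitivity-bound {n} {d} (suc k) {f} {p} {r} sep p-deg r-deg r-deg-k
  with argmax (λ x → ∣ p x ∣)
... | x , max with p x ≟ 0ℚ
...   | yes px≡0 =
  ℕₚ.≤-trans (ℕₚ.≤-reflexive (constant⇒totalSensitivity≡0 f false is-false)) z≤n
  where
  p≡0 : ∀ y → p y ≡ 0ℚ
  p≡0 y = ℚₚ.∣p∣≡0⇒p≡0 (p y)
    (ℚₚ.≤-antisym (ℚₚ.≤-trans (max y) (ℚₚ.≤-reflexive (cong ∣_∣ px≡0))) (ℚₚ.0≤∣p∣ (p y)))
  is-false : ∀ y → f y ≡ false
  is-false y with sep y
  ... | inj₁ (_ , py≢0 , _) = contradiction (p≡0 y) py≢0
  ... | inj₂ (fy , _) = fy
...   | no px≢0 with Certificate.certificate p-deg r-deg r≢0⇒p≡0 x px≢0 max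
  where
  r≢0⇒p≡0 : ∀ y → r y ≢ 0ℚ → p y ≡ 0ℚ
  r≢0⇒p≡0 y ry≢0 with sep y
  ... | inj₁ (_ , _ , ry≡0) = contradiction ry≡0 ry≢0
  ... | inj₂ (_ , py≡0 , _) = py≡0
...     | S , S-size , r≡0 = begin
  totalSensitivity f
    ≤⟨ totalSensitivity-mux f S _ (λ z → totalSensitivity-bound k (sep ∘ mux S z)
         (mux-Deg< S z p-deg) (mux-Deg< S z r-deg) (restricted-Deg< z)) ⟩
  2 ℕ.^ n ℕ.* size S ℕ.+ 2 ℕ.^ n ℕ.* (k ℕ.* certificateSize d)
    ≤⟨ ℕₚ.+-monoˡ-≤ _ (ℕₚ.*-monoʳ-≤ (2 ℕ.^ n) S-size) ⟩
  2 ℕ.^ n ℕ.* certificateSize d ℕ.+ 2 ℕ.^ n ℕ.* (k ℕ.* certificateSize d)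
    ≡⟨ ℕₚ.*-distribˡ-+ (2 ℕ.^ n) (certificateSize d) (k ℕ.* certificateSize d) ⟨
  2 ℕ.^ n ℕ.* (suc k ℕ.* certificateSize d) ∎
  where
  open ℕₚ.≤-Reasoning
  restricted-Deg< : ∀ z → Deg< k (λ y → r (mux S z y))
  -- With `S` fixed as in x, r is zero, so any other restriction of `S` equals a difference of two
  -- restrictions and has lower degree.
  restricted-Deg< z = Deg<-resp (mux-difference-Deg< S z x r-deg-k) λ y →
    trans (cong (λ u → r (mux S z y) - u) (r≡0 y)) (ℚₚ.+-identityʳ (r (mux S z y)))

-- Lower bound on influences

isNonzero-0 : ∀ {q} → q ≡ 0ℚ → isNonzero q ≡ 0
isNonzero-0 refl = refl

isNonzero≤1 : ∀ q → isNonzero q ℕ.≤ 1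
isNonzero≤1 q with q ≟ 0ℚ
... | yes _ = z≤n
... | no  _ = s≤s z≤n

p*q≢0 : ∀ {p q} → p ≢ 0ℚ → q ≢ 0ℚ → p * q ≢ 0ℚ
p*q≢0 {p} {q} p≢0 q≢0 pq≡0 = p≢0 (begin
  p              ≡⟨ ℚₚ.*-identityʳ p ⟨
  p * 1ℚ         ≡⟨ cong (p *_) (ℚₚ.*-inverseʳ q) ⟨
  p * (q * 1/ q) ≡⟨ ℚₚ.*-assoc p q (1/ q) ⟨
  p * q * 1/ q   ≡⟨ cong (_* 1/ q) pq≡0 ⟩
  0ℚ * 1/ q      ≡⟨ ℚₚ.*-zeroˡ (1/ q) ⟩
  0ℚ             ∎)
  where
  open ≡-Reasoning
  instance
    q-nonZero : NonZero q
    q-nonZero = ≢-nonZero q≢0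

flipAt-involutive : ∀ {n} (x : Cube n) i → flipAt (flipAt x i) i ≡ x
flipAt-involutive (b ∷ x) zero = cong (_∷ x) (not-involutive b)
flipAt-involutive (b ∷ x) (suc i) = cong (b ∷_) (flipAt-involutive x i)

-- The product of p at y and r at the flipped point is nonzero exactly when f drops from true to
-- false under the flip. It has degree at most 2d and is not identically zero, because f depends on
-- i.
influence-lower-bound : ∀ {n d} {f : BoolFun n} {p r : Cube n → ℚ} → Separates p r f →
  Deg< (suc d) p → Deg< (suc d) r → ∀ i → DependsOn f i → 2 ℕ.^ n ℕ.≤ 2 ℕ.^ (d ℕ.+ d) ℕ.* influence f i
influence-lower-bound {n} {d} {f} {p} {r} sep p-deg r-deg i (x , fx≢fxⁱ)
  with schwartz-zippel (Deg<-* p-deg (flip-Deg< i r-deg))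
... | inj₂ le = ℕₚ.*-cancelˡ-≤ 2 (begin
  2 ℕ.* 2 ℕ.^ n                                         ≤⟨ le ⟩
  2 ℕ.* 2 ℕ.^ (d ℕ.+ d) ℕ.* Σᶜ (isNonzero ∘ pr)          ≡⟨ ℕₚ.*-assoc 2 (2 ℕ.^ (d ℕ.+ d)) (Σᶜ (isNonzero ∘ pr)) ⟩
  2 ℕ.* (2 ℕ.^ (d ℕ.+ d) ℕ.* Σᶜ (isNonzero ∘ pr))        ≤⟨ ℕₚ.*-monoʳ-≤ 2 (ℕₚ.*-monoʳ-≤ (2 ℕ.^ (d ℕ.+ d)) (Σᶜ-mono detects)) ⟩
  2 ℕ.* (2 ℕ.^ (d ℕ.+ d) ℕ.* influence f i)             ∎)
  where
  open ℕₚ.≤-Reasoning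
  pr : Cube n → ℚ
  pr y = p y * r (flipAt y i)
  detects : ∀ y → isNonzero (pr y) ℕ.≤ differ (f y) (f (flipAt y i))
  detects y with sep y | sep (flipAt y i)
  ... | inj₂ (_ , py≡0 , _) | _ =
    ℕₚ.≤-trans (ℕₚ.≤-reflexive (isNonzero-0 (trans (cong (_* r (flipAt y i)) py≡0) (ℚₚ.*-zeroˡ (r (flipAt y i)))))) z≤n
  ... | inj₁ _ | inj₁ (_ , _ , ryⁱ≡0) =
    ℕₚ.≤-trans (ℕₚ.≤-reflexive (isNonzero-0 (trans (cong (p y *_) ryⁱ≡0) (ℚₚ.*-zeroʳ (p y))))) z≤n
  ... | inj₁ (fy , _) | inj₂ (fyⁱ , _) =
    ℕₚ.≤-trans (isNonzero≤1 (pr y)) (ℕₚ.≤-reflexive (sym (cong₂ differ fy fyⁱ)))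
... | inj₁ pr≡0 with sep x | sep (flipAt x i)
...   | inj₁ (fx , _) | inj₁ (fxⁱ , _) = contradiction (trans fx (sym fxⁱ)) fx≢fxⁱ
...   | inj₂ (fx , _) | inj₂ (fxⁱ , _) = contradiction (trans fx (sym fxⁱ)) fx≢fxⁱ
...   | inj₁ (_ , px≢0 , _) | inj₂ (_ , _ , rxⁱ≢0) = contradiction (pr≡0 x) (p*q≢0 px≢0 rxⁱ≢0)
-- Here f rises from x to its neighbour, so the product is nonzero at the neighbour, whose flip is x
-- again.
...   | inj₂ (_ , _ , rx≢0) | inj₁ (_ , pxⁱ≢0 , _) = contradiction (pr≡0 (flipAt x i))
  (p*q≢0 pxⁱ≢0 λ e → rx≢0 (trans (sym (cong r (flipAt-involutive x i))) e))

-- Constants and conclusion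

n<2^n : ∀ n → n ℕ.< 2 ℕ.^ n
n<2^n zero = s≤s z≤n
n<2^n (suc n) = begin-strict
  suc n                        <⟨ s≤s (n<2^n n) ⟩
  1 ℕ.+ 2 ℕ.^ n                ≤⟨ ℕₚ.+-mono-≤ (ℕₚ.m^n>0 2 n) (ℕₚ.m≤m+n (2 ℕ.^ n) 0) ⟩
  2 ℕ.^ suc n                  ∎
  where open ℕₚ.≤-Reasoning

-- The exponent 7d is 2d from the influences, d from d + 1 ≤ 2^d, 3d from 5^d ≤ 8^d, and d from d ≤
-- 2^d.
constants-bound : ∀ d → 2 ℕ.^ (d ℕ.+ d) ℕ.* (suc d ℕ.* certificateSize d) ℕ.≤ 2 ℕ.^ (7 ℕ.* d)
constants-bound d = begin
  2 ℕ.^ (d ℕ.+ d) ℕ.* (suc d ℕ.* (5 ℕ.^ d ℕ.* d))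
    ≤⟨ ℕₚ.*-monoʳ-≤ (2 ℕ.^ (d ℕ.+ d)) (ℕₚ.*-mono-≤ (n<2^n d)
         (ℕₚ.*-mono-≤ (ℕₚ.^-monoˡ-≤ d 5≤8) (ℕₚ.<⇒≤ (n<2^n d)))) ⟩
  2 ℕ.^ (d ℕ.+ d) ℕ.* (2 ℕ.^ d ℕ.* (8 ℕ.^ d ℕ.* 2 ℕ.^ d))
    ≡⟨ cong (λ z → 2 ℕ.^ (d ℕ.+ d) ℕ.* (2 ℕ.^ d ℕ.* (z ℕ.* 2 ℕ.^ d))) (ℕₚ.^-*-assoc 2 3 d) ⟩
  2 ℕ.^ (d ℕ.+ d) ℕ.* (2 ℕ.^ d ℕ.* (2 ℕ.^ (3 ℕ.* d) ℕ.* 2 ℕ.^ d))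
    ≡⟨ cong (λ z → 2 ℕ.^ (d ℕ.+ d) ℕ.* (2 ℕ.^ d ℕ.* z)) (ℕₚ.^-distribˡ-+-* 2 (3 ℕ.* d) d) ⟨
  2 ℕ.^ (d ℕ.+ d) ℕ.* (2 ℕ.^ d ℕ.* 2 ℕ.^ (3 ℕ.* d ℕ.+ d))
    ≡⟨ cong (2 ℕ.^ (d ℕ.+ d) ℕ.*_) (ℕₚ.^-distribˡ-+-* 2 d (3 ℕ.* d ℕ.+ d)) ⟨
  2 ℕ.^ (d ℕ.+ d) ℕ.* 2 ℕ.^ (d ℕ.+ (3 ℕ.* d ℕ.+ d))
    ≡⟨ ℕₚ.^-distribˡ-+-* 2 (d ℕ.+ d) (d ℕ.+ (3 ℕ.* d ℕ.+ d)) ⟨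
  2 ℕ.^ (d ℕ.+ d ℕ.+ (d ℕ.+ (3 ℕ.* d ℕ.+ d)))
    ≡⟨ cong (2 ℕ.^_) (exponent d) ⟩
  2 ℕ.^ (7 ℕ.* d) ∎
  where
  open ℕₚ.≤-Reasoning
  5≤8 : 5 ℕ.≤ 8
  5≤8 = ℕₚ.m≤m+n 5 3
  exponent : ∀ d → d ℕ.+ d ℕ.+ (d ℕ.+ (3 ℕ.* d ℕ.+ d)) ≡ 7 ℕ.* d
  exponent = ℕ-Ring.solve-∀

-- On the cube p = f·q and q - p = (1 - f)·q, with q nowhere zero.
separates : ∀ {n} (f : BoolFun n) p q → IsRationalRep f p q →
            Separates (eval p) (λ x → eval q x - eval p x) f
separates f p q rep x with f x in fx | rep x
... | true | q≢0 , p≡ = inj₁ (refl , (λ e → q≢0 (trans (sym p≡q) e)) ,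
                               trans (cong (λ z → eval q x - z) p≡q) (ℚₚ.+-inverseʳ (eval q x)))
  where
  p≡q : eval p x ≡ eval q x
  p≡q = trans p≡ (ℚₚ.*-identityˡ (eval q x))
... | false | q≢0 , p≡ = inj₂ (refl , p≡0 , λ e → q≢0 (trans (sym q-p≡q) e))
  where
  p≡0 : eval p x ≡ 0ℚ
  p≡0 = trans p≡ (ℚₚ.*-zeroˡ (eval q x))
  q-p≡q : eval q x - eval p x ≡ eval q x
  q-p≡q = trans (cong (λ z → eval q x - z) p≡0) (ℚₚ.+-identityʳ (eval q x))

-- Taking base-2 logarithms, the inequality with k = 7 reads d ≥ (log n)/7, so c = 1/7.
theorem4p5 : ∃ λ (k : ℕ) →
    ∀ (n : ℕ) → 2 ℕ.≤ n → (f : BoolFun n) → DependsOnAll f →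
    ∀ (d : ℕ) → RdegAtMost f d → n ℕ.≤ 2 ℕ.^ (k ℕ.* d)
theorem4p5 = 7 , λ n _ f depends d (p , q , rep , p-size , q-size) →
  let
    open ℕₚ.≤-Reasoning
    p-deg = eval-Deg< n (suc d) p λ S pS≢0 → s≤s (p-size S pS≢0)
    q-deg = eval-Deg< n (suc d) q λ S qS≢0 → s≤s (q-size S qS≢0)
    r-deg = Deg<-minus q-deg p-deg
    sep = separates f p q rep
  in ℕₚ.*-cancelʳ-≤ n _ (2 ℕ.^ n) {{ℕₚ.m^n≢0 2 n}} (begin
    n ℕ.* 2 ℕ.^ n
      -- Double counting: the n influences, each at least 2^n / 4^d, sum to the total sensitivity.
      ≤⟨ sum-lower-bound n {c = 2 ℕ.^ (d ℕ.+ d)} (influence f) (λ i → influence-lower-bound sep p-deg r-deg i (depends i)) ⟩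
    2 ℕ.^ (d ℕ.+ d) ℕ.* sum (influence f)
      ≡⟨ cong (2 ℕ.^ (d ℕ.+ d) ℕ.*_) (Σᶜ-sum n λ x i → differ (f x) (f (flipAt x i))) ⟨
    2 ℕ.^ (d ℕ.+ d) ℕ.* totalSensitivity f
      ≤⟨ ℕₚ.*-monoʳ-≤ (2 ℕ.^ (d ℕ.+ d)) (totalSensitivity-bound (suc d) sep p-deg r-deg r-deg) ⟩
    2 ℕ.^ (d ℕ.+ d) ℕ.* (2 ℕ.^ n ℕ.* (suc d ℕ.* certificateSize d))
      ≡⟨ arrange (2 ℕ.^ (d ℕ.+ d)) (2 ℕ.^ n) (suc d ℕ.* certificateSize d) ⟩
    2 ℕ.^ (d ℕ.+ d) ℕ.* (suc d ℕ.* certificateSize d) ℕ.* 2 ℕ.^ n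
      ≤⟨ ℕₚ.*-monoˡ-≤ (2 ℕ.^ n) (constants-bound d) ⟩
    2 ℕ.^ (7 ℕ.* d) ℕ.* 2 ℕ.^ n ∎)
  where
  arrange : ∀ a b c → a ℕ.* (b ℕ.* c) ≡ a ℕ.* c ℕ.* b
  arrange = ℕ-Ring.solve-∀
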